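{- Let $w\in\{0,1\}^*$ be a finite binary word. If $w$ is good, then $\delta(w)$ is good.
   Context: Words are over the alphabet $\{0,1\}$. A factor of a word is a contiguous subword. A morphism $g:\{0,1\}^*\to\{0,1\}^*$ is written $g=[g(0),g(1)]$; it is non-erasing if $g(0)$ and $g(1)$ are both non-empty. A word $w$ encounters a pattern $p\in\{0,1\}^*$ if $g(p)$ is a factor of $w$ for some non-erasing morphism $g:\{0,1\}^*\to\{0,1\}^*$. A binary word is called good if it contains neither $11$ nor $1001$ as a factor, and encounters neither of the patterns $0000$ and $00010100$. The period-doubling morphism is $\delta=[01,00]$, i.e. $\delta(0)=01$, $\delta(1)=00$. -}

module Defs where

open import Data.Fin.Base using (Fin)
open import Data.Fin.Patterns using (0F; 1F)
open import Data.List.Base using (List; []; _∷_; concatMap)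
open import Data.List.Relation.Binary.Infix.Heterogeneous using (Infix)
open import Data.Product.Base using (Σ-syntax; _×_)
open import Relation.Binary.PropositionalEquality.Core using (_≡_; _≢_)
open import Relation.Nullary.Negation.Core using (¬_)

Letter : Set
Letter = Fin 2

Word : Set
Word = List Letter

_isFactorOf_ : Word → Word → Set
u isFactorOf w = Infix _≡_ u w

-- {0,1}* is the free monoid on {0,1}, so a morphism {0,1}* → {0,1}* is
-- given by the images of the two letters; `apply` is its action on words.
Morphism : Set
Morphism = Letter → Word

[_,_] : Word → Word → Morphism
[ u , v ] 0F = u
[ u , v ] 1F = v

apply : Morphism → Word → Word
apply = concatMap

NonErasing : Morphism → Set
NonErasing g = g 0F ≢ [] × g 1F ≢ []

_encounters_ : Word → Word → Set
w encounters p = Σ[ g ∈ Morphism ] NonErasing g × (apply g p isFactorOf w)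

record Good (w : Word) : Set where
  field
    no-11       : ¬ ((1F ∷ 1F ∷ []) isFactorOf w)
    no-1001     : ¬ ((1F ∷ 0F ∷ 0F ∷ 1F ∷ []) isFactorOf w)
    no-0000     : ¬ (w encounters (0F ∷ 0F ∷ 0F ∷ 0F ∷ []))
    no-00010100 : ¬ (w encounters
                      (0F ∷ 0F ∷ 0F ∷ 1F ∷ 0F ∷ 1F ∷ 0F ∷ 0F ∷ []))

δ : Morphism
δ = [ 0F ∷ 1F ∷ [] , 0F ∷ 0F ∷ [] ]

{-# OPTIONS --safe #-}

-- In δ(w) the letters at even positions are 0 and the letters at odd positions are the
-- complements of the letters of w.  So a word occurring in δ(w) at positions of both
-- parities is a power of 0, while an occurrence of g(x) in which g maps both letters to
-- words of even length yields an encounter of x in w.  What remains are morphisms with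
-- an image of odd length, and since δ(w) has no factor 0000 the only one that survives
-- is g(0) = 0 with |g(1)| odd, for the pattern 00010100.  Reading off the letters of w
-- turns this occurrence into a factor 1vv1 of w.  But in w consecutive 1s are separated
-- by one or three 0s, so the 1s of w all have the same parity of position: contradiction.
module Submission where

open import Defs
open import Data.Empty using (⊥; ⊥-elim)
open import Data.Fin.Base using (opposite)
open import Data.Fin.Patterns using (0F; 1F)
open import Data.List.Base using ([]; _∷_; _++_; length)
open import Data.List.Properties using (++-assoc; length-++)
open import Data.List.Relation.Binary.Infix.Heterogeneous using (here; there; _++ⁱ_)
import Data.List.Relation.Binary.Infix.Heterogeneous.Properties as Infix
import Data.List.Relation.Binary.Pointwise as Pointwise
open import Data.List.Relation.Binary.Prefix.Heterogeneous using (Prefix; []; _∷_; _++ᵖ_)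
import Data.List.Relation.Binary.Prefix.Heterogeneous.Properties as Prefix
open import Data.List.Relation.Unary.All using (All; []; _∷_)
open import Data.Nat.Base using (parity)
open import Data.Parity.Base using (Parity; 0ℙ; 1ℙ; _⁻¹; _+_)
open import Data.Parity.Properties using (+-homo-+; p+p≡0ℙ)
open import Data.Product.Base using (∃-syntax; _×_; _,_; proj₁; proj₂)
open import Data.Unit.Base using (⊤; tt)
open import Relation.Binary.PropositionalEquality
  using (_≡_; _≢_; refl; sym; trans; cong; subst)
open import Relation.Nullary.Negation.Core using (¬_)

prefix-isFactorOf : ∀ u {v w} → (u ++ v) isFactorOf w → u isFactorOf w
prefix-isFactorOf u {v} =
  Infix.trans trans (here (Prefix.fromPointwise (Pointwise.refl refl) ++ᵖ v))

suffix-isFactorOf : ∀ u {v w} → (u ++ v) isFactorOf w → v isFactorOf w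
suffix-isFactorOf u =
  Infix.trans trans (u ++ⁱ here (Prefix.fromPointwise (Pointwise.refl refl)))

square-even : ∀ (u : Word) → parity (length (u ++ u)) ≡ 0ℙ
square-even u =
  trans (cong parity (length-++ u)) (trans (+-homo-+ (length u) (length u)) (p+p≡0ℙ (parity (length u))))

-- In ZeroAtEven p u and odds p u, the parity p is that of the position of the first
-- letter of u.
ZeroAtEven : Parity → Word → Set
ZeroAtEven _  []      = ⊤
ZeroAtEven 0ℙ (a ∷ u) = a ≡ 0F × ZeroAtEven 1ℙ u
ZeroAtEven 1ℙ (_ ∷ u) = ZeroAtEven 0ℙ u

odds : Parity → Word → Word
odds _  []      = []
odds 0ℙ (_ ∷ u) = odds 1ℙ u
odds 1ℙ (a ∷ u) = opposite a ∷ odds 0ℙ u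

-- The recursion takes two letters at a time: `parity` computes in steps of two, and the parity of
-- the position is then unchanged.
ZeroAtEven-++⁻ : ∀ p u {v} → ZeroAtEven p (u ++ v) →
                 ZeroAtEven p u × ZeroAtEven (parity (length u) + p) v
ZeroAtEven-++⁻ p  []          z       = tt , z
ZeroAtEven-++⁻ 0ℙ (a ∷ [])    (e , z) = (e , tt) , z
ZeroAtEven-++⁻ 1ℙ (a ∷ [])    z       = tt , z
ZeroAtEven-++⁻ 0ℙ (a ∷ b ∷ u) (e , z) =
  let zu , zv = ZeroAtEven-++⁻ 0ℙ u z in (e , zu) , zv
ZeroAtEven-++⁻ 1ℙ (a ∷ b ∷ u) (e , z) =
  let zu , zv = ZeroAtEven-++⁻ 1ℙ u z in (e , zu) , zv

odds-++ : ∀ p u v → odds p (u ++ v) ≡ odds p u ++ odds (parity (length u) + p) v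
odds-++ p  []          v = refl
odds-++ 0ℙ (a ∷ [])    v = refl
odds-++ 1ℙ (a ∷ [])    v = refl
odds-++ 0ℙ (a ∷ b ∷ u) v = cong (opposite b ∷_) (odds-++ 0ℙ u v)
odds-++ 1ℙ (a ∷ b ∷ u) v = cong (opposite a ∷_) (odds-++ 1ℙ u v)

odds-≢[] : ∀ p u → parity (length u) ≡ 0ℙ → u ≢ [] → odds p u ≢ []
odds-≢[] p  []          _  u≢[] = λ _ → u≢[] refl
odds-≢[] 0ℙ (a ∷ b ∷ u) _  _    = λ ()
odds-≢[] 1ℙ (a ∷ b ∷ u) _  _    = λ ()

-- Images of even length make every block start at the same parity `p`, so one morphism decodes all
-- blocks.
odds-apply : ∀ p g → (∀ a → parity (length (g a)) ≡ 0ℙ) →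
             ∀ x → odds p (apply g x) ≡ apply (λ a → odds p (g a)) x
odds-apply p g even []      = refl
odds-apply p g even (a ∷ x) rewrite odds-++ p (g a) (apply g x) | even a =
  cong (odds p (g a) ++_) (odds-apply p g even x)

zero-at-both : ∀ p u → ZeroAtEven p u → ZeroAtEven (p ⁻¹) u → All (_≡ 0F) u
zero-at-both _  []      _       _        = []
zero-at-both 0ℙ (a ∷ u) (e , z) z′       = e ∷ zero-at-both 1ℙ u z z′
zero-at-both 1ℙ (a ∷ u) z       (e , z′) = e ∷ zero-at-both 0ℙ u z z′

-- The two copies of `u` start at positions of opposite parity.
zero-at-odd-shift : ∀ p u {v} → parity (length u) ≡ 1ℙ →
                    ZeroAtEven p (u ++ u ++ v) → All (_≡ 0F) u
zero-at-odd-shift p u odd z with zu , z′ ← ZeroAtEven-++⁻ p u z rewrite odd =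
  zero-at-both p u zu (proj₁ (ZeroAtEven-++⁻ (p ⁻¹) u z′))

δ-zeroAtEven : ∀ w → ZeroAtEven 0ℙ (apply δ w)
δ-zeroAtEven []       = tt
δ-zeroAtEven (0F ∷ w) = refl , δ-zeroAtEven w
δ-zeroAtEven (1F ∷ w) = refl , δ-zeroAtEven w

odds-δ : ∀ w → odds 0ℙ (apply δ w) ≡ w
odds-δ []       = refl
odds-δ (0F ∷ w) = cong (0F ∷_) (odds-δ w)
odds-δ (1F ∷ w) = cong (1F ∷_) (odds-δ w)

prefix-odds : ∀ p {u v} → Prefix _≡_ u v → ZeroAtEven p v →
              ZeroAtEven p u × Prefix _≡_ (odds p u) (odds p v)
prefix-odds p  []         z       = tt , []
prefix-odds 0ℙ (refl ∷ q) (e , z) = let z′ , q′ = prefix-odds 1ℙ q z in (e , z′) , q′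
prefix-odds 1ℙ (refl ∷ q) z       = let z′ , q′ = prefix-odds 0ℙ q z in z′ , refl ∷ q′

factor-odds : ∀ p {u v} → u isFactorOf v → ZeroAtEven p v →
              ∃[ q ] ZeroAtEven q u × odds q u isFactorOf odds p v
factor-odds p  (here pre)  z       = let z′ , pre′ = prefix-odds p pre z in p , z′ , here pre′
factor-odds 0ℙ (there inf) (_ , z) = factor-odds 1ℙ inf z
factor-odds 1ℙ (there inf) z       = let q , z′ , inf′ = factor-odds 0ℙ inf z in q , z′ , there inf′

desubstitute : ∀ w {u} → u isFactorOf apply δ w →
               ∃[ p ] ZeroAtEven p u × odds p u isFactorOf w
desubstitute w f with p , z , f′ ← factor-odds 0ℙ f (δ-zeroAtEven w) =
  p , z , subst (_ isFactorOf_) (odds-δ w) f′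

even-encounter : ∀ w g x → (∀ a → parity (length (g a)) ≡ 0ℙ) → NonErasing g →
                 apply g x isFactorOf apply δ w → w encounters x
even-encounter w g x even (g0≢[] , g1≢[]) f with p , _ , f′ ← desubstitute w f =
  (λ a → odds p (g a)) ,
  (odds-≢[] p (g 0F) (even 0F) g0≢[] , odds-≢[] p (g 1F) (even 1F) g1≢[]) ,
  subst (_isFactorOf w) (odds-apply p g even x) f′

module _ {w : Word} (good : Good w) where
  open Good good

  private
    w′ : Word
    w′ = apply δ w

  no-11-prefix : ∀ {u} → ¬ (1F ∷ 1F ∷ u) isFactorOf w
  no-11-prefix f = no-11 (prefix-isFactorOf (1F ∷ 1F ∷ []) f)

  -- Induction over the 1s inside `u`. Gaps of zero, two, or at least four 0s are excluded, so a gap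
  -- together with the 1 closing it has two or four letters, and removing it preserves parity.
  ones-separated-by-odd : ∀ u {v} → (1F ∷ u ++ 1F ∷ v) isFactorOf w → parity (length u) ≡ 1ℙ
  ones-separated-by-odd []                      f = ⊥-elim (no-11-prefix f)
  ones-separated-by-odd (1F ∷ u)                f = ⊥-elim (no-11-prefix f)
  ones-separated-by-odd (0F ∷ [])               f = refl
  ones-separated-by-odd (0F ∷ 1F ∷ u)           f =
    ones-separated-by-odd u (suffix-isFactorOf (1F ∷ 0F ∷ []) f)
  ones-separated-by-odd (0F ∷ 0F ∷ [])          f =
    ⊥-elim (no-1001 (prefix-isFactorOf (1F ∷ 0F ∷ 0F ∷ 1F ∷ []) f))
  ones-separated-by-odd (0F ∷ 0F ∷ 1F ∷ u)      f =
    ⊥-elim (no-1001 (prefix-isFactorOf (1F ∷ 0F ∷ 0F ∷ 1F ∷ []) f))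
  ones-separated-by-odd (0F ∷ 0F ∷ 0F ∷ [])     f = refl
  ones-separated-by-odd (0F ∷ 0F ∷ 0F ∷ 1F ∷ u) f =
    ones-separated-by-odd u (suffix-isFactorOf (1F ∷ 0F ∷ 0F ∷ 0F ∷ []) f)
  ones-separated-by-odd (0F ∷ 0F ∷ 0F ∷ 0F ∷ u) f =
    -- The letter 1 does not occur in the pattern 0000, so its image may be any non-empty word.
    ⊥-elim (no-0000 ([ 0F ∷ [] , 0F ∷ [] ] , ((λ ()) , (λ ())) ,
      prefix-isFactorOf (0F ∷ 0F ∷ 0F ∷ 0F ∷ []) (suffix-isFactorOf (1F ∷ []) f)))

  no-1vv1 : ∀ v {u} → ¬ (1F ∷ v ++ v ++ 1F ∷ u) isFactorOf w
  no-1vv1 v {u} f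
    with () ← trans (sym (square-even v)) (ones-separated-by-odd (v ++ v)
                (subst (λ t → (1F ∷ t) isFactorOf w) (sym (++-assoc v v (1F ∷ u))) f))

  δ-no-11 : ¬ (1F ∷ 1F ∷ []) isFactorOf w′
  δ-no-11 f with desubstitute w f
  ... | 0ℙ , (() , _) , _
  ... | 1ℙ , (() , _) , _

  δ-no-1001 : ¬ (1F ∷ 0F ∷ 0F ∷ 1F ∷ []) isFactorOf w′
  δ-no-1001 f with desubstitute w f
  ... | 0ℙ , (() , _) , _
  ... | 1ℙ , (_ , () , _) , _

  -- Two of the four 0s stand at odd positions and decode to 11 in `w`.
  δ-no-four-zeros : ∀ {u} → ¬ (0F ∷ 0F ∷ 0F ∷ 0F ∷ u) isFactorOf w′
  δ-no-four-zeros f with desubstitute w f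
  ... | 0ℙ , _ , f′ = no-11-prefix f′
  ... | 1ℙ , _ , f′ = no-11-prefix f′

  zero-square : ∀ u {v} → All (_≡ 0F) u → u ≢ [] → (u ++ u ++ v) isFactorOf w′ → u ≡ 0F ∷ []
  zero-square []                  _                   u≢[] f = ⊥-elim (u≢[] refl)
  zero-square (_ ∷ [])            (refl ∷ [])         _    f = refl
  zero-square (_ ∷ _ ∷ [])        (refl ∷ refl ∷ [])  _    f = ⊥-elim (δ-no-four-zeros f)
  zero-square (_ ∷ _ ∷ _ ∷ [])    (refl ∷ refl ∷ refl ∷ []) _ f =
    ⊥-elim (δ-no-four-zeros f)
  zero-square (_ ∷ _ ∷ _ ∷ _ ∷ _) (refl ∷ refl ∷ refl ∷ refl ∷ _) _ f =
    ⊥-elim (δ-no-four-zeros f)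

  odd-square : ∀ u {v} → parity (length u) ≡ 1ℙ → u ≢ [] → (u ++ u ++ v) isFactorOf w′ →
               u ≡ 0F ∷ []
  odd-square u odd u≢[] f with p , z , _ ← desubstitute w f =
    zero-square u (zero-at-odd-shift p u odd z) u≢[] f

  δ-no-0000 : ¬ w′ encounters (0F ∷ 0F ∷ 0F ∷ 0F ∷ [])
  δ-no-0000 (g , (g0≢[] , _) , f) with parity (length (g 0F)) in |g0|
  -- The parity of `g 1F` is unknown; the constant morphism agrees with `g` on 0000 and has only
  -- even images.
  ... | 0ℙ = no-0000 (even-encounter w (λ _ → g 0F) (0F ∷ 0F ∷ 0F ∷ 0F ∷ [])
                         (λ _ → |g0|) (g0≢[] , g0≢[]) f)
  ... | 1ℙ = δ-no-four-zeros (subst (λ u → (u ++ u ++ u ++ u ++ []) isFactorOf w′)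
                                    (odd-square (g 0F) |g0| g0≢[] f) f)

  no-000b0b00 : ∀ b {u} → b ≢ [] →
                ¬ (0F ∷ 0F ∷ 0F ∷ b ++ 0F ∷ b ++ 0F ∷ 0F ∷ u) isFactorOf w′
  no-000b0b00 [] b≢[] f = b≢[] refl
  no-000b0b00 b@(_ ∷ _) {u} _ f with desubstitute w f
  -- The first and third 0 stand at odd positions and decode to 11.
  ... | 1ℙ , _ , f′ = no-11-prefix f′
  ... | 0ℙ , (_ , _ , z) , f′
    with z₁ , z′ ← ZeroAtEven-++⁻ 1ℙ b z
    rewrite odds-++ 1ℙ b (0F ∷ b ++ 0F ∷ 0F ∷ u)
    with parity (length b) in |b|
  -- Both copies of `b` start at odd positions and decode to the same word; the second 0 of 000 and
  -- the last of the displayed 0s decode to the 1s around the square.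
  ... | 1ℙ rewrite odds-++ 1ℙ b (0F ∷ 0F ∷ u) | |b| = no-1vv1 (odds 1ℙ b) f′
  -- The 0 between the copies of `b` shifts the parity, so `b` consists of 0s; its first letter, at
  -- an odd position, decodes to a 1 right after the 1 from 000.
  ... | 0ℙ with zero-at-both 1ℙ b z₁ (proj₁ (ZeroAtEven-++⁻ 0ℙ b z′))
  ...   | refl ∷ _ = no-11-prefix f′

  δ-no-00010100 : ¬ w′ encounters (0F ∷ 0F ∷ 0F ∷ 1F ∷ 0F ∷ 1F ∷ 0F ∷ 0F ∷ [])
  δ-no-00010100 (g , (g0≢[] , g1≢[]) , f) with parity (length (g 0F)) in |g0|
  ... | 1ℙ = no-000b0b00 (g 1F) g1≢[]
    (subst (λ u → (u ++ u ++ u ++ g 1F ++ u ++ g 1F ++ u ++ u ++ []) isFactorOf w′)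
           (odd-square (g 0F) |g0| g0≢[] f) f)
  δ-no-00010100 (g , (g0≢[] , g1≢[]) , f) | 0ℙ with parity (length (g 1F)) in |g1|
  ... | 0ℙ = no-00010100
    (even-encounter w g (0F ∷ 0F ∷ 0F ∷ 1F ∷ 0F ∷ 1F ∷ 0F ∷ 0F ∷ [])
      (λ { 0F → |g0| ; 1F → |g1| }) (g0≢[] , g1≢[]) f)
  ... | 1ℙ = contra
    where
    a b : Word
    a = g 0F
    b = g 1F

    zero : All (_≡ 0F) a
    -- Dropping two copies of `a` leaves a word starting with `a`, `b`, `a`. As `a` is even and `b`
    -- odd, these two copies of `a` start at opposite parities.
    zero with p , z , _ ← desubstitute w (suffix-isFactorOf a (suffix-isFactorOf a f))
      with za , z₁ ← ZeroAtEven-++⁻ p a z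
      with _ , z₂ ← ZeroAtEven-++⁻ _ b z₁
      with za′ , _ ← ZeroAtEven-++⁻ _ a z₂
      rewrite |g0| | |g1| = zero-at-both p a za za′

    contra : ⊥
    -- The square at the start of the occurrence forces `a` to be the single letter 0, of odd
    -- length.
    contra with () ← trans (sym |g0|) (cong (λ u → parity (length u)) (zero-square a zero g0≢[] f))

theorem1p5 : (w : Word) → Good w → Good (apply δ w)
theorem1p5 w good = record
  { no-11       = δ-no-11 good
  ; no-1001     = δ-no-1001 good
  ; no-0000     = δ-no-0000 good
  ; no-00010100 = δ-no-00010100 good
  }
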